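{- Let $\Gamma$ be an embedded (ribbon) graph and let $a,b$ be two distinct edges of $\Gamma$ such that an end of $a$ and an end of $b$ are neighbors in the cyclic order at some vertex. Let $\Gamma'_{ab}$ be the ribbon graph obtained from $\Gamma$ by exchanging these two neighboring ends. Then $D(\Gamma'_{ab})=D(\Gamma)'_{ab}$.
   Context: An embedded (ribbon) graph is a connected graph cellularly embedded in a compact surface, orientable or not (edges are ribbons; loops may be orientable or half-twisted). Its delta-matroid is $D(\Gamma)=(E(\Gamma);\Phi(\Gamma))$, where $\phi\subseteq E(\Gamma)$ is feasible iff the spanning ribbon subgraph with all vertices of $\Gamma$ and edge set $\phi$ has boundary consisting of exactly one connected component. For a set system $D=(E;\Phi)$ and distinct $a,b\in E$: the twist is $D*E'=(E;\{\phi\Delta E'\mid\phi\in\Phi\})$; the sliding of $a$ over $b$ is $\widetilde D_{ab}=(E;\Phi\,\Delta\,\{\phi\sqcup\{a\}\mid\phi\subseteq E\setminus\{a,b\},\ \phi\sqcup\{b\}\in\Phi\})$; and $D'_{ab}=\big(\widetilde{(D*\{b\})}_{ab}\big)*\{b\}$. -}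

module Defs where

open import Data.Bool using (Bool; true; false; if_then_else_)
import Data.Bool.Properties as Bool
open import Data.Fin using (Fin)
import Data.Fin.Properties as Fin
import Data.Fin.Subset as Subset
open Subset using (Subset; ⁅_⁆)
open import Data.Nat using (ℕ; zero; suc; NonZero)
open import Data.Nat.GeneralisedArithmetic using (fold)
open import Data.Product using (_×_; _,_; ∃-syntax)
import Data.Product.Properties as Product
open import Data.Sum using (_⊎_; [_,_]′)
open import Function using (_↔_; Inverse; mk↔ₛ′; _⇔_; mk⇔; Equivalence)
open import Function.Construct.Composition using (_↔-∘_)
open import Level using (0ℓ)
open import Relation.Binary using (DecidableEquality)
open import Relation.Binary.Construct.Closure.Equivalence using (EqClosure)
open import Relation.Binary.PropositionalEquality
open import Relation.Nullary using (Dec; does; yes; no; contradiction)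
open import Relation.Unary using (Pred; _∪_; _∖_)

------------------------------------------------------------------------
-- Set systems

-- The ground set is Fin n.
SetSystem : ℕ → Set₁
SetSystem n = Pred (Subset n) 0ℓ

_△_ : ∀ {n} → Subset n → Subset n → Subset n
p △ q = (p Subset.─ q) Subset.∪ (q Subset.─ p)

_Δ_ : ∀ {n} → SetSystem n → SetSystem n → SetSystem n
Φ Δ Ψ = (Φ ∖ Ψ) ∪ (Ψ ∖ Φ)

infixl 7 _*_ _△_
infixl 6 _Δ_

_*_ : ∀ {n} → SetSystem n → Subset n → SetSystem n
(Φ * E′) ψ = ∃[ φ ] Φ φ × ψ ≡ φ △ E′

-- { φ ⊔ {a} ∣ φ ⊆ E ∖ {a,b}, φ ⊔ {b} ∈ Φ }
slid : ∀ {n} → SetSystem n → Fin n → Fin n → SetSystem n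
slid Φ a b ψ =
  ∃[ φ ] a Subset.∉ φ × b Subset.∉ φ × Φ (φ Subset.∪ ⁅ b ⁆) × ψ ≡ φ Subset.∪ ⁅ a ⁆

-- D̃_{ab}
slide : ∀ {n} → SetSystem n → Fin n → Fin n → SetSystem n
slide Φ a b = Φ Δ slid Φ a b

-- D′_{ab}
exchangeEnds : ∀ {n} → SetSystem n → Fin n → Fin n → SetSystem n
exchangeEnds D a b = slide (D * ⁅ b ⁆) a b * ⁅ b ⁆

------------------------------------------------------------------------
-- Ribbon graphs

-- The two ends of the edge e are (e , false) and (e , true).
End : ℕ → Set
End n = Fin n × Bool

_≟ᵉ_ : ∀ {n} → DecidableEquality (End n)
_≟ᵉ_ = Product.≡-dec Fin._≟_ Bool._≟_

-- A connected ribbon graph with edge set Fin n, as a signed rotation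
-- system: every vertex disc is given an orientation, `rotate` sends an
-- end to the next one around its vertex, and a ribbon is `twisted` when
-- it is not compatible with the orientations chosen at its two ends
-- (for a loop: when it is half-twisted).  Both the discs and their
-- orientations are arbitrary, so the surface need not be orientable.
record RibbonGraph (n : ℕ) : Set where
  field
    #vertices : ℕ
    origin    : End n → Fin #vertices
    rotate    : End n ↔ End n
    twisted   : Fin n → Bool

  next : End n → End n
  next = Inverse.to rotate

  Adjacent : Fin #vertices → Fin #vertices → Set
  Adjacent u w = ∃[ e ] origin (e , false) ≡ u × origin (e , true) ≡ w

  field
    -- The ends at a vertex form a single cycle of `rotate`.
    cyclic    : ∀ h k → origin h ≡ origin k ⇔ (∃[ m ] fold h next m ≡ k)
    nonEmpty  : NonZero #vertices
    connected : ∀ u w → EqClosure Adjacent u w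

------------------------------------------------------------------------
-- The boundary of a spanning ribbon subgraph

data Side : Set where
  before after : Side

opposite : Side → Side
opposite before = after
opposite after  = before

module _ {n : ℕ} (Γ : RibbonGraph n) where
  open RibbonGraph Γ

  -- The end h is attached along an arc of the boundary circle of its
  -- vertex; `corner h before` and `corner h after` are the first and the
  -- last point of that arc.  The boundary circle of a vertex without
  -- ends carries no corner and is recorded as a single point.
  data BoundaryPoint : Set where
    corner : End n → Side → BoundaryPoint
    circle : (u : Fin #vertices) → .(∀ h → origin h ≢ u) → BoundaryPoint

  -- The arcs composing the boundary of the spanning ribbon subgraph with
  -- edge set φ:
  --   gap   the part of a vertex circle between two consecutive ends;
  --   cap   the part of a vertex circle freed by removing a ribbon;
  --   edge  a long side of a ribbon.  If the ribbon respects the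
  --         orientations, its long sides join `before` to `after`.
  data Arc (φ : Subset n) : BoundaryPoint → BoundaryPoint → Set where
    gap  : ∀ h → Arc φ (corner h after) (corner (next h) before)
    cap  : ∀ {e} i → e Subset.∉ φ →
           Arc φ (corner (e , i) before) (corner (e , i) after)
    edge : ∀ {e} s → e Subset.∈ φ →
           Arc φ (corner (e , false) s)
                 (corner (e , true) (if twisted e then s else opposite s))

  ConnectedBoundary : Subset n → Set
  ConnectedBoundary φ = ∃[ x ] (∀ y → EqClosure (Arc φ) x y)

  deltaMatroid : SetSystem n
  deltaMatroid = ConnectedBoundary

------------------------------------------------------------------------
-- Exchanging two neighbouring ends

Neighbours : ∀ {n} → RibbonGraph n → End n → End n → Set
Neighbours Γ α β = next α ≡ β ⊎ next β ≡ α
  where open RibbonGraph Γ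

swap : ∀ {n} → End n → End n → End n → End n
swap α β h =
  if does (h ≟ᵉ α) then β else (if does (h ≟ᵉ β) then α else h)

module _ {n : ℕ} (α β : End n) where

  swap-α : swap α β α ≡ β
  swap-α with α ≟ᵉ α
  ... | yes _  = refl
  ... | no α≢α = contradiction refl α≢α

  swap-β : swap α β β ≡ α
  swap-β with β ≟ᵉ α
  ... | yes β≡α = β≡α
  ... | no _ with β ≟ᵉ β
  ...   | yes _  = refl
  ...   | no β≢β = contradiction refl β≢β

  swap-fixed : ∀ {h} → h ≢ α → h ≢ β → swap α β h ≡ h
  swap-fixed {h} h≢α h≢β with h ≟ᵉ α
  ... | yes h≡α = contradiction h≡α h≢α
  ... | no _ with h ≟ᵉ β
  ...   | yes h≡β = contradiction h≡β h≢β
  ...   | no _    = refl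

  swap-involutive : ∀ h → swap α β (swap α β h) ≡ h
  swap-involutive h = go (h ≟ᵉ α) (h ≟ᵉ β)
    where
    go : Dec (h ≡ α) → Dec (h ≡ β) → swap α β (swap α β h) ≡ h
    go (yes refl) _          = trans (cong (swap α β) swap-α) swap-β
    go (no _)     (yes refl) = trans (cong (swap α β) swap-β) swap-α
    go (no h≢α)   (no h≢β)   =
      trans (cong (swap α β) (swap-fixed h≢α h≢β)) (swap-fixed h≢α h≢β)

  swap↔ : End n ↔ End n
  swap↔ = mk↔ₛ′ (swap α β) (swap α β) swap-involutive swap-involutive

module _ {n : ℕ} (Γ : RibbonGraph n) (α β : End n) (nb : Neighbours Γ α β) where
  open RibbonGraph Γ

  private
    τ : End n → End n
    τ = swap α β

  neighbours-origin : origin α ≡ origin β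
  neighbours-origin = [ (λ αβ → Equivalence.from (cyclic α β) (1 , αβ))
                      , (λ βα → sym (Equivalence.from (cyclic β α) (1 , βα))) ]′ nb

  swap-origin : ∀ h → origin (τ h) ≡ origin h
  swap-origin h with h ≟ᵉ α | h ≟ᵉ β
  ... | yes h≡α | _       = trans (sym neighbours-origin) (cong origin (sym h≡α))
  ... | no _    | yes h≡β = trans neighbours-origin (cong origin (sym h≡β))
  ... | no _    | no _    = refl

  fold-swap : ∀ h m → fold h (λ k → τ (next (τ k))) m ≡ τ (fold (τ h) next m)
  fold-swap h zero    = sym (swap-involutive α β h)
  fold-swap h (suc m) = cong (λ k → τ (next k))
    (trans (cong τ (fold-swap h m)) (swap-involutive α β _))

  -- Conjugating the rotation by the transposition (α β) exchanges α and
  -- β in the cyclic order; nothing else changes.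
  exchange : RibbonGraph n
  exchange = record
    { #vertices = #vertices
    ; origin    = origin
    ; rotate    = swap↔ α β ↔-∘ (rotate ↔-∘ swap↔ α β)
    ; twisted   = twisted
    ; cyclic    = λ h k → mk⇔ (to h k) (from h k)
    ; nonEmpty  = nonEmpty
    ; connected = connected
    }
    where
    to : ∀ h k → origin h ≡ origin k →
         ∃[ m ] fold h (λ l → τ (next (τ l))) m ≡ k
    to h k eq
      with m , p ← Equivalence.to (cyclic (τ h) (τ k))
                     (trans (swap-origin h) (trans eq (sym (swap-origin k))))
      = m , trans (fold-swap h m) (trans (cong τ p) (swap-involutive α β k))

    from : ∀ h k → ∃[ m ] fold h (λ l → τ (next (τ l))) m ≡ k →
           origin h ≡ origin k
    from h k (m , p) =
      trans (sym (swap-origin h))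
        (trans (Equivalence.from (cyclic (τ h) (fold (τ h) next m)) (m , refl))
          (trans (sym (swap-origin _))
            (cong origin (trans (sym (fold-swap h m)) p))))

{-# OPTIONS --safe #-}
module Submission where

-- Cut Γ open along a and b: all other ribbons and all vertex circles then
-- form arcs joining the eight corners of a and b in pairs, and possibly
-- closed curves, and a spanning ribbon subgraph can only have connected
-- boundary if there are no closed curves.  Up to renaming the corners at
-- the two exchanged ends, Γ and Γ′ have the same outer part and differ in
-- how a and b join these corners.  What remains is a parity statement on
-- the pairings of eight points that join the neighbouring corners of the
-- two ends: for ψ ∋ a, b, an even number of ψ in Γ, ψ in Γ′ and
-- ψ ∖ {a, b} in Γ have a connected boundary; for other ψ, the boundaries
-- of ψ in Γ and Γ′ are both connected or both disconnected.

open import Defs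
open import Data.Bool using (Bool; true; false; _∧_; _∨_; _xor_; not; if_then_else_)
import Data.Bool.Properties as Bool
open import Data.Empty using (⊥-elim-irr)
open import Data.Fin using (Fin; suc)
open import Data.Fin.Patterns using (0F; 1F)
import Data.Fin.Properties as Fin
open import Data.Fin.Subset as Subset using (Subset; ⁅_⁆)
open import Data.Fin.Subset.Properties using (x∈⁅x⁆; x≢y⇒x∉⁅y⁆)
open import Data.List using (List; []; _∷_; _++_; map; foldr; foldl; concatMap; filter; allFin)
import Data.List.Membership.DecPropositional as DecMembership
open import Data.List.Membership.Propositional using (_∈_; _∉_)
open import Data.List.Membership.Propositional.Properties using (∈-filter⁺; ∈-filter⁻; ∈-allFin)
open import Data.List.Properties using (foldr-++; map-∘; map-cong)
open import Data.List.Relation.Unary.All as All using (All; []; _∷_)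
import Data.List.Relation.Unary.All.Properties as All
open import Data.List.Relation.Unary.AllPairs using ([]; _∷_)
open import Data.List.Relation.Unary.Any as Any using (here; there)
open import Data.List.Relation.Unary.Unique.Propositional using (Unique)
open import Data.List.Relation.Unary.Unique.Propositional.Properties using (filter⁺; allFin⁺)
open import Data.Nat using (ℕ)
open import Data.Product as Product using (_×_; _,_; proj₁; proj₂; uncurry; ∃-syntax)
open import Data.Product.Properties using (≡-dec)
open import Data.Sum as Sum using (_⊎_; inj₁; inj₂)
open import Data.Unit using (⊤; tt)
open import Data.Vec using (_∷_; lookup; _[_]≔_)
open import Data.Vec.Properties using (lookup⇒[]=; []=⇒lookup; lookup-zipWith; lookup∘update; lookup∘update′)
open import Data.Vec.Relation.Binary.Pointwise.Extensional using (ext; Pointwise-≡⇒≡)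
open import Function using (_∘_; _⇔_; mk⇔; Equivalence; Inverse)
open import Function.Construct.Composition using (_⇔-∘_)
open import Function.Construct.Symmetry using (⇔-sym)
open import Level using (0ℓ)
open import Relation.Binary using (Rel; Decidable; DecidableEquality; IsEquivalence; _⇒_)
open import Relation.Binary.Construct.Closure.Equivalence as EqClosure using (EqClosure)
open import Relation.Binary.Construct.Closure.ReflexiveTransitive using (ε; _◅_)
open import Relation.Binary.Construct.Closure.Symmetric using (fwd; bwd)
import Relation.Binary.Construct.On as On
open import Relation.Binary.PropositionalEquality
open import Relation.Nullary using (Dec; does; yes; no; contradiction; ¬_; map′; toWitness)
open import Relation.Nullary.Decidable using (_×-dec_; _⊎-dec_; _→-dec_; ¬?; dec-true)
open import Relation.Unary using (Pred; _≐_)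

private
  variable
    A B : Set
    n : ℕ
    R : Rel A 0ℓ

-- Adding arcs to an equivalence relation

both : (A → B) → A × A → B × B
both f (x , y) = f x , f y

-- For an equivalence `R`, a path can be shortened to use the arc `(u , v)` at most once; hence
-- three alternatives suffice, and decidability of `R` is inherited.
join : A × A → Rel A 0ℓ → Rel A 0ℓ
join (u , v) R x y = R x y ⊎ (R x u × R v y) ⊎ (R x v × R u y)

Linked : Rel A 0ℓ → List (A × A) → Rel A 0ℓ
Linked = foldr join

Total : Rel A 0ℓ → Set
Total R = ∀ x y → R x y

join-isEquivalence : ∀ p → IsEquivalence R → IsEquivalence (join p R)
join-isEquivalence {R = R} (u , v) R-eq = record { refl = inj₁ refl′ ; sym = sym′ ; trans = trans′ }
  where
  open IsEquivalence R-eq renaming (refl to refl′; sym to symᴿ; trans to transᴿ)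
  sym′ : ∀ {x y} → join (u , v) R x y → join (u , v) R y x
  sym′ (inj₁ xy)               = inj₁ (symᴿ xy)
  sym′ (inj₂ (inj₁ (xu , vy))) = inj₂ (inj₂ (symᴿ vy , symᴿ xu))
  sym′ (inj₂ (inj₂ (xv , uy))) = inj₂ (inj₁ (symᴿ uy , symᴿ xv))
  trans′ : ∀ {x y z} → join (u , v) R x y → join (u , v) R y z → join (u , v) R x z
  trans′ (inj₁ xy) (inj₁ yz)                             = inj₁ (transᴿ xy yz)
  trans′ (inj₁ xy) (inj₂ (inj₁ (yu , vz)))               = inj₂ (inj₁ (transᴿ xy yu , vz))
  trans′ (inj₁ xy) (inj₂ (inj₂ (yv , uz)))               = inj₂ (inj₂ (transᴿ xy yv , uz))
  trans′ (inj₂ (inj₁ (xu , vy))) (inj₁ yz)               = inj₂ (inj₁ (xu , transᴿ vy yz))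
  trans′ (inj₂ (inj₂ (xv , uy))) (inj₁ yz)               = inj₂ (inj₂ (xv , transᴿ uy yz))
  trans′ (inj₂ (inj₁ (xu , _))) (inj₂ (inj₁ (_ , vz)))   = inj₂ (inj₁ (xu , vz))
  trans′ (inj₂ (inj₁ (xu , _))) (inj₂ (inj₂ (_ , uz)))   = inj₁ (transᴿ xu uz)
  trans′ (inj₂ (inj₂ (xv , _))) (inj₂ (inj₁ (_ , vz)))   = inj₁ (transᴿ xv vz)
  trans′ (inj₂ (inj₂ (xv , _))) (inj₂ (inj₂ (_ , uz)))   = inj₂ (inj₂ (xv , uz))

linked-isEquivalence : IsEquivalence R → ∀ L → IsEquivalence (Linked R L)
linked-isEquivalence R-eq []      = R-eq
linked-isEquivalence R-eq (p ∷ L) = join-isEquivalence p (linked-isEquivalence R-eq L)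

linked-base : ∀ (L : List (A × A)) → R ⇒ Linked R L
linked-base []      r = r
linked-base (_ ∷ L) r = inj₁ (linked-base L r)

linked-arcs : IsEquivalence R → ∀ L → All (uncurry (Linked R L)) L
linked-arcs R-eq []      = []
linked-arcs R-eq (p ∷ L) =
  inj₂ (inj₁ (refl′ , refl′)) ∷ All.map inj₁ (linked-arcs R-eq L)
  where open IsEquivalence (linked-isEquivalence R-eq L) renaming (refl to refl′)

-- Together with `linked-base`, `linked-arcs` and `linked-isEquivalence`, this makes `Linked R L`
-- the equivalence generated by `R` and `L`.
linked-least : ∀ {R S : Rel A 0ℓ} → IsEquivalence S → R ⇒ S → ∀ {L} → All (uncurry S) L → Linked R L ⇒ S
linked-least S-eq R⇒S {[]} []       r = R⇒S r
linked-least {R = R} {S} S-eq R⇒S {(u , v) ∷ L} (uv ∷ ps) {x} {y} = go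
  where
  open IsEquivalence S-eq renaming (sym to symˢ; trans to transˢ)
  ih : Linked R L ⇒ S
  ih = linked-least S-eq R⇒S ps
  go : join (u , v) (Linked R L) x y → S x y
  go (inj₁ r)                = ih r
  go (inj₂ (inj₁ (xu , vy))) = transˢ (ih xu) (transˢ uv (ih vy))
  go (inj₂ (inj₂ (xv , uy))) = transˢ (ih xv) (transˢ (symˢ uv) (ih uy))

-- `join` mentions only `x`, `y` and the ends of the arc, never other intermediate points, so the
-- equivalence passes from one arc to the next. Serves both to rename corners and to pass from ports
-- to corners.
linked-map : ∀ {R : Rel A 0ℓ} {S : Rel B 0ℓ} (f : A → B) → (∀ x y → R x y ⇔ S (f x) (f y)) →
             ∀ L x y → Linked R L x y ⇔ Linked S (map (both f) L) (f x) (f y)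
linked-map f R⇔S []            x y = R⇔S x y
linked-map {R = R} {S} f R⇔S ((u , v) ∷ L) x y = mk⇔
    (Sum.map (to x y) (Sum.map (λ (p , q) → to x u p , to v y q) (λ (p , q) → to x v p , to u y q)))
    (Sum.map (from x y) (Sum.map (λ (p , q) → from x u p , from v y q) (λ (p , q) → from x v p , from u y q)))
  where
  ih = linked-map f R⇔S L
  to : ∀ x y → Linked R L x y → Linked S (map (both f) L) (f x) (f y)
  to x y = Equivalence.to (ih x y)
  from : ∀ x y → Linked S (map (both f) L) (f x) (f y) → Linked R L x y
  from x y = Equivalence.from (ih x y)

linked? : ∀ {R : Rel A 0ℓ} → Decidable R → ∀ L → Decidable (Linked R L)
linked? R? []            = R?
linked? R? ((u , v) ∷ L) x y =
  R′? x y ⊎-dec (R′? x u ×-dec R′? v y) ⊎-dec (R′? x v ×-dec R′? u y)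
  where R′? = linked? R? L

total-cong : ∀ {R : Rel A 0ℓ} {S : Rel B 0ℓ} (f : A → B) (g : B → A) → (∀ y → f (g y) ≡ y) →
             (∀ x y → R x y ⇔ S (f x) (f y)) → Total R ⇔ Total S
total-cong {S = S} f g fg R⇔S = mk⇔
  (λ total x y → subst₂ S (fg x) (fg y) (Equivalence.to (R⇔S _ _) (total _ _)))
  (λ total x y → Equivalence.from (R⇔S x y) (total _ _))

-- Pairings

Mate : (A → A) → Rel A 0ℓ
Mate f x y = y ≡ x ⊎ y ≡ f x

mate-isEquivalence : ∀ {f : A → A} → (∀ x → f (f x) ≡ x) → IsEquivalence (Mate f)
mate-isEquivalence {f = f} f² = record { refl = inj₁ refl ; sym = sym′ ; trans = trans′ }
  where
  sym′ : ∀ {x y} → Mate f x y → Mate f y x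
  sym′ (inj₁ refl) = inj₁ refl
  sym′ (inj₂ refl) = inj₂ (sym (f² _))
  trans′ : ∀ {x y z} → Mate f x y → Mate f y z → Mate f x z
  trans′ (inj₁ refl) yz          = yz
  trans′ (inj₂ refl) (inj₁ refl) = inj₂ refl
  trans′ (inj₂ refl) (inj₂ refl) = inj₁ (f² _)

-- Every class of R meets O in no point or in exactly two points.
PairedOn : Pred A 0ℓ → Rel A 0ℓ → Set
PairedOn O R = ∀ x → O x → ∃[ y ] O y × y ≢ x × R x y × (∀ z → O z → R x z → z ≡ x ⊎ z ≡ y)

pairedOn-resp : ∀ {O O′ : Pred A 0ℓ} → O ≐ O′ → PairedOn O R → PairedOn O′ R
pairedOn-resp (to , from) pair x Ox with y , Oy , y≢x , xy , uniq ← pair x (from Ox) =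
  y , to Oy , y≢x , xy , λ z Oz → uniq z (from Oz)

Without : A → A → Pred A 0ℓ → Pred A 0ℓ
Without u v O x = O x × x ≢ u × x ≢ v

-- Since x is paired with u and v with w, the arc (u , v) pairs x with w.
pairedOn-reroute : ∀ {O : Pred A 0ℓ} {u v x} → IsEquivalence R → u ≢ v → O u → O v → PairedOn O R →
                   O x → x ≢ u → x ≢ v → R x u →
                   ∃[ w ] Without u v O w × w ≢ x × join (u , v) R x w ×
                          (∀ z → Without u v O z → join (u , v) R x z → z ≡ x ⊎ z ≡ w)
pairedOn-reroute {R = R} {O} {u} {v} {x} R-eq u≢v Ou Ov pair Ox x≢u x≢v xu
  with pair x Ox | pair v Ov
... | y , _ , _ , _ , x-uniq | w , Ow , w≢v , vw , v-uniq =
  w , (Ow , (λ { refl → ¬xv (transᴿ xu (symᴿ vw)) }) , w≢v) ,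
  (λ { refl → ¬xv (symᴿ vw) }) , inj₂ (inj₁ (xu , vw)) , uniq
  where
  open IsEquivalence R-eq renaming (sym to symᴿ; trans to transᴿ)
  only-u : ∀ {z} → O z → R x z → z ≡ x ⊎ z ≡ u
  only-u Oz xz with x-uniq _ Oz xz | x-uniq u Ou xu
  ... | inj₁ z≡x | _        = inj₁ z≡x
  ... | inj₂ _   | inj₁ u≡x = contradiction (sym u≡x) x≢u
  ... | inj₂ z≡y | inj₂ u≡y = inj₂ (trans z≡y (sym u≡y))
  ¬xv : ¬ R x v
  ¬xv xv with only-u Ov xv
  ... | inj₁ v≡x = x≢v (sym v≡x)
  ... | inj₂ v≡u = u≢v (sym v≡u)
  uniq : ∀ z → Without u v O z → join (u , v) R x z → z ≡ x ⊎ z ≡ w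
  uniq z (Oz , z≢u , _) (inj₁ xz)              = Sum.map₂ (λ z≡u → contradiction z≡u z≢u) (only-u Oz xz)
  uniq z (Oz , _ , z≢v) (inj₂ (inj₁ (_ , vz))) with v-uniq z Oz vz
  ... | inj₁ z≡v = contradiction z≡v z≢v
  ... | inj₂ z≡w = inj₂ z≡w
  uniq z _              (inj₂ (inj₂ (xv , _))) = contradiction xv ¬xv

-- If the partner of `x` is `u` or `v`, the pairing continues across the new arc; otherwise the arc
-- does not touch the class of `x`. If `u` and `v` are partners of each other, the arc closes a
-- curve, whose class contains none of the remaining points.
pairedOn-join : ∀ {O : Pred A 0ℓ} {u v} → DecidableEquality A → IsEquivalence R → u ≢ v → O u → O v →
                PairedOn O R → PairedOn (Without u v O) (join (u , v) R)
pairedOn-join {R = R} {O} {u} {v} _≟_ R-eq u≢v Ou Ov pair x (Ox , x≢u , x≢v)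
  with pair x Ox
... | y , Oy , y≢x , xy , x-uniq with y ≟ u | y ≟ v
...   | yes refl | _        = pairedOn-reroute R-eq u≢v Ou Ov pair Ox x≢u x≢v xy
...   | no _     | yes refl
  with w , (Ow , w≢v , w≢u) , w≢x , xw , uniq ← pairedOn-reroute R-eq (u≢v ∘ sym) Ov Ou pair Ox x≢v x≢u xy =
  w , (Ow , w≢u , w≢v) , w≢x , Sum.map₂ Sum.swap xw ,
  λ z (Oz , z≢u , z≢v) xz → uniq z (Oz , z≢v , z≢u) (Sum.map₂ Sum.swap xz)
...   | no y≢u   | no y≢v   = y , (Oy , y≢u , y≢v) , y≢x , inj₁ xy , uniq
  where
  not-linked : ∀ {w} → O w → x ≢ w → y ≢ w → ¬ R x w
  not-linked Ow x≢w y≢w xw with x-uniq _ Ow xw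
  ... | inj₁ w≡x = x≢w (sym w≡x)
  ... | inj₂ w≡y = y≢w (sym w≡y)
  uniq : ∀ z → Without u v O z → join (u , v) R x z → z ≡ x ⊎ z ≡ y
  uniq z (Oz , _) (inj₁ xz)              = x-uniq z Oz xz
  uniq z _        (inj₂ (inj₁ (xu , _))) = contradiction xu (not-linked Ou x≢u y≢u)
  uniq z _        (inj₂ (inj₂ (xv , _))) = contradiction xv (not-linked Ov x≢v y≢v)

-- Corners of ribbons

Corner : ℕ → Set
Corner n = End n × Side

_≟ˢ_ : DecidableEquality Side
before ≟ˢ before = yes refl
before ≟ˢ after  = no λ ()
after  ≟ˢ before = no λ ()
after  ≟ˢ after  = yes refl

_≟ᶜ_ : DecidableEquality (Corner n)
_≟ᶜ_ = ≡-dec _≟ᵉ_ _≟ˢ_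

allCorners? : ∀ {P : Corner n → Set} → (∀ c → Dec (P c)) → Dec (∀ c → P c)
allCorners? {P = P} P? =
  map′ (λ p ((e , i) , s) → at (p e) i s) (λ p e → (p _ , p _) , (p _ , p _))
    (Fin.all? λ e → (P? _ ×-dec P? _) ×-dec (P? _ ×-dec P? _))
  where
  at : ∀ {e} → (P ((e , false) , before) × P ((e , false) , after)) ×
               (P ((e , true)  , before) × P ((e , true)  , after)) →
       ∀ i s → P ((e , i) , s)
  at ((p , _) , _) false before = p
  at ((_ , p) , _) false after  = p
  at (_ , (p , _)) true  before = p
  at (_ , (_ , p)) true  after  = p

-- `true` stands for a ribbon that is present and lists its two long sides; `false` stands for a
-- removed one and lists the caps at its two ends.
ribbon : Bool → (Bool → Side → A) → List (A × A)
ribbon true  c = (c false before , c true before)  ∷ (c false after , c true after) ∷ []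
ribbon false c = (c false before , c false after) ∷ (c true before , c true after) ∷ []

ribbon-pairedOn : ∀ {O : Pred A 0ℓ} → DecidableEquality A → IsEquivalence R → ∀ x (c : Bool → Side → A) →
                  (∀ {i s i′ s′} → c i s ≡ c i′ s′ → i ≡ i′ × s ≡ s′) → (∀ i s → O (c i s)) →
                  PairedOn O R → PairedOn (λ y → O y × (∀ i s → y ≢ c i s)) (Linked R (ribbon x c))
ribbon-pairedOn {A = A} {R} {O} _≟_ R-eq x c c-inj Oc pair = go x
  where
  end≢ : ∀ {s s′} → c false s ≢ c true s′
  end≢ eq = contradiction (proj₁ (c-inj eq)) λ ()
  side≢ : ∀ {i i′} → c i before ≢ c i′ after
  side≢ eq = contradiction (proj₂ (c-inj eq)) λ ()
  Open : Pred A 0ℓ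
  Open y = O y × (∀ i s → y ≢ c i s)
  go : ∀ x → PairedOn Open (Linked R (ribbon x c))
  go true = pairedOn-resp
    ( (λ ((Oy , p , q) , r , s) → Oy ,
        λ { false before → r ; true before → s ; false after → p ; true after → q })
    , λ (Oy , ≢c) → (Oy , ≢c _ _ , ≢c _ _) , ≢c _ _ , ≢c _ _)
    (pairedOn-join _≟_ (join-isEquivalence _ R-eq) end≢
      (Oc _ _ , side≢ , side≢) (Oc _ _ , side≢ , side≢)
      (pairedOn-join _≟_ R-eq end≢ (Oc _ _) (Oc _ _) pair))
  go false = pairedOn-resp
    ( (λ ((Oy , p , q) , r , s) → Oy ,
        λ { false before → r ; false after → s ; true before → p ; true after → q })
    , λ (Oy , ≢c) → (Oy , ≢c _ _ , ≢c _ _) , ≢c _ _ , ≢c _ _)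
    (pairedOn-join _≟_ (join-isEquivalence _ R-eq) side≢
      (Oc _ _ , end≢ , end≢) (Oc _ _ , end≢ , end≢)
      (pairedOn-join _≟_ R-eq side≢ (Oc _ _) (Oc _ _) pair))

along : Bool → Bool → Side → Side
along twisted far s = if far then (if twisted then s else opposite s) else s

along-involutive : ∀ t i s → along t i (along t i s) ≡ s
along-involutive t     false s      = refl
along-involutive true  true  s      = refl
along-involutive false true  before = refl
along-involutive false true  after  = refl

xor-involutive : ∀ x y → x xor (x xor y) ≡ y
xor-involutive x y = trans (sym (Bool.xor-assoc x x y)) (cong (_xor y) (Bool.xor-same x))

-- The corners of the edge e as seen from its end (e , i); the sides at the
-- far end are named so that the long sides of the ribbon join equal sides.
edgeCorner : (Fin n → Bool) → Fin n → Bool → Bool → Side → Corner n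
edgeCorner tw e i far s = (e , i xor far) , along (tw e) far s

edgeCorner-injective : ∀ (tw : Fin n → Bool) e i {k s k′ s′} →
                       edgeCorner tw e i k s ≡ edgeCorner tw e i k′ s′ → k ≡ k′ × s ≡ s′
edgeCorner-injective tw e i {k} {s} {k′} {s′} eq
  with refl ← trans (sym (xor-involutive i k))
                (trans (cong ((i xor_) ∘ proj₂ ∘ proj₁) eq) (xor-involutive i k′)) =
  refl , trans (sym (along-involutive (tw e) k s))
           (trans (cong (along (tw e) k ∘ proj₂) eq) (along-involutive (tw e) k s′))

edgeCorner-surjective : ∀ (tw : Fin n → Bool) e i k s → ∃[ k′ ] ∃[ s′ ] ((e , k) , s) ≡ edgeCorner tw e i k′ s′
edgeCorner-surjective tw e i k s = i xor k , along (tw e) (i xor k) s ,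
  cong₂ (λ k s → (e , k) , s) (sym (xor-involutive i k)) (sym (along-involutive (tw e) (i xor k) s))

ribbons : (Fin n → Bool) → Subset n → List (Fin n) → List (Corner n × Corner n)
ribbons tw φ = concatMap λ e → ribbon (lookup φ e) (edgeCorner tw e false)

-- Each edge uses up exactly its own four corners, by long sides or by caps; `Unique` ensures that
-- they are still open when its arcs are added.
ribbons-pairedOn : ∀ {R : Rel (Corner n) 0ℓ} → IsEquivalence R → PairedOn (λ _ → ⊤) R →
                   ∀ tw φ {es} → Unique es → PairedOn (λ ((e , _) , _) → e ∉ es) (Linked R (ribbons tw φ es))
ribbons-pairedOn R-eq pair tw φ []  = pairedOn-resp ((λ _ ()) , _) pair
ribbons-pairedOn {n} {R} R-eq pair tw φ {e ∷ es} (e∉ ∷ uniq) =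
  pairedOn-resp (to , from)
    (subst (PairedOn Open)
      (sym (foldr-++ join R (ribbon (lookup φ e) corners) (ribbons tw φ es)))
      (ribbon-pairedOn _≟ᶜ_ (linked-isEquivalence R-eq (ribbons tw φ es)) (lookup φ e) corners
        (edgeCorner-injective tw e false) (λ _ _ e∈ → All.lookup e∉ e∈ refl)
        (ribbons-pairedOn R-eq pair tw φ uniq)))
  where
  corners : Bool → Side → Corner n
  corners = edgeCorner tw e false
  Open : Pred (Corner n) 0ℓ
  Open c = proj₁ (proj₁ c) ∉ es × (∀ k s → c ≢ corners k s)
  to : ∀ {c} → Open c → proj₁ (proj₁ c) ∉ e ∷ es
  to {(_ , k) , s} (_ , ≢c) (here refl) with k′ , s′ , eq ← edgeCorner-surjective tw e false k s = ≢c k′ s′ eq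
  to (∉es , _) (there ∈es) = ∉es ∈es
  from : ∀ {c} → proj₁ (proj₁ c) ∉ e ∷ es → Open c
  from ∉e∷es = ∉e∷es ∘ there , λ _ _ eq → ∉e∷es (here (cong (proj₁ ∘ proj₁) eq))

-- Boundary components as classes of corners

module _ (Γ : RibbonGraph n) where
  open RibbonGraph Γ

  gapMate : Corner n → Corner n
  gapMate (h , after)  = next h , before
  gapMate (h , before) = Inverse.from rotate h , after

  gapMate-involutive : ∀ c → gapMate (gapMate c) ≡ c
  gapMate-involutive (h , after)  = cong (_, after) (Inverse.strictlyInverseʳ rotate h)
  gapMate-involutive (h , before) = cong (_, before) (Inverse.strictlyInverseˡ rotate h)

  gapMate-≢ : ∀ c → gapMate c ≢ c
  gapMate-≢ (h , after)  ()
  gapMate-≢ (h , before) ()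

  gaps-pairedOn : PairedOn (λ _ → ⊤) (Mate gapMate)
  gaps-pairedOn c _ = gapMate c , tt , gapMate-≢ c , inj₂ refl , λ _ _ r → r

  gaps-isEquivalence : IsEquivalence (Mate gapMate)
  gaps-isEquivalence = mate-isEquivalence gapMate-involutive

  point : Corner n → BoundaryPoint Γ
  point (h , s) = corner h s

  module _ (φ : Subset n) where

    Joined : Rel (Corner n) 0ℓ
    Joined x y = EqClosure (Arc Γ φ) (point x) (point y)

    joined-isEquivalence : IsEquivalence Joined
    joined-isEquivalence = On.isEquivalence point (EqClosure.isEquivalence (Arc Γ φ))

    open IsEquivalence joined-isEquivalence using () renaming (sym to symᴶ)

    mate⇒joined : Mate gapMate ⇒ Joined
    mate⇒joined (inj₁ refl) = ε
    mate⇒joined {h , after}  (inj₂ refl) = EqClosure.return (gap h)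
    mate⇒joined {h , before} (inj₂ refl) = symᴶ (subst
      (λ k → Joined (Inverse.from rotate h , after) (k , before))
      (Inverse.strictlyInverseˡ rotate h) (EqClosure.return (gap _)))

    ribbon⊆joined : ∀ e i → All (uncurry Joined) (ribbon (lookup φ e) (edgeCorner twisted e i))
    ribbon⊆joined e i with lookup φ e in eq
    ... | true  = line i before ∷ line i after ∷ []
      where
      line : ∀ i s → Joined (edgeCorner twisted e i false s) (edgeCorner twisted e i true s)
      line false s = EqClosure.return (edge s (lookup⇒[]= e φ eq))
      -- Seen from the end `true`, the long side is an `edge` arc run backwards; applying `along`
      -- twice brings its side back to `s`.
      line true  s = symᴶ (subst (λ s′ → Joined ((e , false) , along (twisted e) true s) ((e , true) , s′))
        (along-involutive (twisted e) true s) (EqClosure.return (edge _ (lookup⇒[]= e φ eq))))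
    ... | false = EqClosure.return (cap _ e∉φ) ∷ far ∷ []
      where
      e∉φ : e Subset.∉ φ
      e∉φ e∈φ = contradiction (trans (sym eq) ([]=⇒lookup e∈φ)) λ ()
      far : Joined (edgeCorner twisted e i true before) (edgeCorner twisted e i true after)
      far with twisted e
      ... | true  = EqClosure.return (cap _ e∉φ)
      ... | false = symᴶ (EqClosure.return (cap _ e∉φ))

    edge∈ribbon : ∀ {S : Rel (Corner n) 0ℓ} {e} i → IsEquivalence S →
                  All (uncurry S) (ribbon (lookup φ e) (edgeCorner twisted e i)) →
                  e Subset.∈ φ → ∀ s → S ((e , false) , s) ((e , true) , along (twisted e) true s)
    edge∈ribbon {S = S} {e} i S-eq ss e∈φ s with lookup φ e | []=⇒lookup e∈φ
    edge∈ribbon false S-eq (sb ∷ sa ∷ []) e∈φ before | _ | refl = sb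
    edge∈ribbon false S-eq (sb ∷ sa ∷ []) e∈φ after  | _ | refl = sa
    edge∈ribbon {e = e} true S-eq (sb ∷ sa ∷ []) e∈φ s | _ | refl with twisted e | s
    ... | true  | before = IsEquivalence.sym S-eq sb
    ... | true  | after  = IsEquivalence.sym S-eq sa
    ... | false | before = IsEquivalence.sym S-eq sa
    ... | false | after  = IsEquivalence.sym S-eq sb

    cap∈ribbon : ∀ {S : Rel (Corner n) 0ℓ} {e} i → IsEquivalence S →
                 All (uncurry S) (ribbon (lookup φ e) (edgeCorner twisted e i)) →
                 e Subset.∉ φ → ∀ k → S ((e , k) , before) ((e , k) , after)
    cap∈ribbon {S = S} {e} i S-eq ss e∉φ k with lookup φ e in eq
    ... | true = contradiction (lookup⇒[]= e φ eq) e∉φ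
    cap∈ribbon {S = S} {e} i S-eq (near ∷ far ∷ []) e∉φ k | false = go i k near far
      where
      go : ∀ i k → S ((e , i xor false) , before) ((e , i xor false) , after) →
           S (edgeCorner twisted e i true before) (edgeCorner twisted e i true after) →
           S ((e , k) , before) ((e , k) , after)
      go false false n _ = n
      go true  true  n _ = n
      -- At the far end `along` exchanges the sides of an untwisted ribbon, so its cap is listed
      -- from `after` to `before` and must be reversed.
      go false true  _ f with twisted e
      ... | true  = f
      ... | false = IsEquivalence.sym S-eq f
      go true  false _ f with twisted e
      ... | true  = f
      ... | false = IsEquivalence.sym S-eq f

  module _ (α : End n) where

    -- A path to the origin of `α` is either empty, and then `α` is at `u`, or its first step runs
    -- along an edge with an end at `u`. Hence there are no `circle` points.
    vertex-nonempty : ∀ u → ∃[ h ] origin h ≡ u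
    vertex-nonempty u with connected u (origin α)
    ... | ε                        = α , refl
    ... | fwd (e , p , _) ◅ _      = _ , p
    ... | bwd (e , _ , p) ◅ _      = _ , p

    cornerOf : BoundaryPoint Γ → Corner n
    cornerOf (corner h s) = h , s
    cornerOf (circle u ∄h) = ⊥-elim-irr (let h , p = vertex-nonempty u in ∄h h p)

    -- `S` contains the arcs and lies inside the equivalence they generate, so on corners it is that
    -- equivalence; `circle` points are excluded by `vertex-nonempty`.
    connected⇔total : ∀ {S : Rel (Corner n) 0ℓ} {φ} → IsEquivalence S →
      (∀ {x y} → S x y → Joined φ x y) → (∀ {p q} → Arc Γ φ p q → S (cornerOf p) (cornerOf q)) →
      ConnectedBoundary Γ φ ⇔ Total S
    connected⇔total {S} {φ} S-eq S⇒J A⇒S = mk⇔ to from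
      where
      open IsEquivalence S-eq renaming (sym to symˢ; trans to transˢ)
      to : ConnectedBoundary Γ φ → Total S
      to (p , all) x y = transˢ (symˢ (path x)) (path y)
        where
        path : ∀ x → S (cornerOf p) x
        path x = EqClosure.gfold S-eq cornerOf A⇒S (all (point x))
      from : Total S → ConnectedBoundary Γ φ
      from total = corner α before , λ
        { (corner h s)  → S⇒J (total _ _)
        ; (circle u ∄h) → ⊥-elim-irr (let h , p = vertex-nonempty u in ∄h h p) }

-- Pairings of the corners of two edges

-- The corners of two abstract edges 0F and 1F, whose ends (0F , false) and
-- (1F , false) are the neighbouring ones.
Port : Set
Port = Corner 2

port : Fin 2 → Bool → Side → Port
port e i s = (e , i) , s

swapPort : Port → Port
swapPort (h , s) = swap (0F , false) (1F , false) h , s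

-- The primed arcs are those of the exchanged graph after renaming its corners by the transposition,
-- which gives both graphs the same outer part.
portArcs portArcs′ : Bool → Bool → List (Port × Port)
portArcs  x y = ribbon x (port 0F) ++ ribbon y (port 1F)
portArcs′ x y = map (both swapPort) (portArcs x y)

Table : Set
Table = List (Port × Port)

Tabulated : Table → Rel Port 0ℓ
Tabulated M k l = l ≡ k ⊎ (k , l) ∈ M

basePort : Port
basePort = port 0F false before

Spans : Table → List (Port × Port) → Set
Spans M L = ∀ l → Linked (Tabulated M) L basePort l

open DecMembership (≡-dec (_≟ᶜ_ {2}) (_≟ᶜ_ {2})) using (_∈?_)

opaque
  spans? : ∀ M L → Dec (Spans M L)
  spans? M L = allCorners? λ l → linked? (λ k l → (l ≟ᶜ k) ⊎-dec ((k , l) ∈? M)) L basePort l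

Parity : Table → Set
Parity M = ∀ x y → does (spans? M (portArcs′ x y)) ≡
  does (spans? M (portArcs x y)) xor (x ∧ y ∧ does (spans? M (portArcs false false)))

allBools? : ∀ {P : Bool → Set} → (∀ x → Dec (P x)) → Dec (∀ x → P x)
allBools? P? = map′ (λ (p , q) → λ { false → p ; true → q }) (λ p → p _ , p _) (P? false ×-dec P? true)

parity? : ∀ M → Dec (Parity M)
parity? M = allBools? λ x → allBools? λ y → _ Bool.≟ _

Neighbouring : Rel Port 0ℓ → Set
Neighbouring R = R (port 0F false after) (port 1F false before) ⊎
                 R (port 1F false after) (port 0F false before)

NeighbouringIn : Table → Set
NeighbouringIn M = Neighbouring λ k l → (k , l) ∈ M

ParityIfNeighbouring : Table → Set
ParityIfNeighbouring M = NeighbouringIn M → Parity M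

parityIfNeighbouring? : ∀ M → Dec (ParityIfNeighbouring M)
parityIfNeighbouring? M = ((_ ∈? M) ⊎-dec (_ ∈? M)) →-dec parity? M

-- Adding k ↦ l to the table of part of a fixed-point-free involution is
-- not visibly wrong.
Fits : Port → Port → Table → Set
Fits k l M = l ≢ k × All (λ (k′ , l′) → (l ≡ k′ → l′ ≡ k) × (l′ ≡ k → l ≡ k′)) M

fits? : ∀ k l M → Dec (Fits k l M)
fits? k l M = ¬? (l ≟ᶜ k) ×-dec
  All.all? (λ (k′ , l′) → (l ≟ᶜ k′ →-dec l′ ≟ᶜ k) ×-dec (l′ ≟ᶜ k →-dec l ≟ᶜ k′)) M

-- Quantification over pairings in a form decidable by evaluation: values are chosen port by port.
-- On all eight ports, `Fits` leaves exactly the 7·5·3·1 = 105 fixed-point-free involutions.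
Search : List Port → Table → (Table → Set) → Set
Search []       M C = C M
Search (k ∷ ks) M C = ∀ l → Fits k l M → Search ks ((k , l) ∷ M) C

search? : ∀ ks M {C} → (∀ M → Dec (C M)) → Dec (Search ks M C)
search? []       M C? = C? M
search? (k ∷ ks) M C? = allCorners? λ l → fits? k l M →-dec search? ks ((k , l) ∷ M) C?

fill : (Port → Port) → List Port → Table → Table
fill f ks M = foldl (λ M k → (k , f k) ∷ M) M ks

Graph⊇ : (Port → Port) → Table → Set
Graph⊇ f = All λ (k , l) → l ≡ f k

-- A genuine fixed-point-free involution passes every `Fits` test, so its table is one of the leaves
-- of the search.
search-sound : ∀ {f} {C : Table → Set} → (∀ k → f k ≢ k) → (∀ k → f (f k) ≡ k) → ∀ ks {M} →
               Graph⊇ f M → Search ks M C → C (fill f ks M)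
search-sound f≢ f² []               M⊆f found = found
search-sound {f} {C} f≢ f² (k ∷ ks) M⊆f found =
  search-sound {C = C} f≢ f² ks (refl ∷ M⊆f) (found (f k) (f≢ k , All.map fits M⊆f))
  where
  fits : ∀ {(k′ , l′) : Port × Port} → l′ ≡ f k′ → (f k ≡ k′ → l′ ≡ k) × (l′ ≡ k → f k ≡ k′)
  fits refl = (λ { refl → f² k }) , λ { refl → f² _ }

fill-graph : ∀ {f} ks {M} → Graph⊇ f M → Graph⊇ f (fill f ks M)
fill-graph []       M⊆f = M⊆f
fill-graph (k ∷ ks) M⊆f = fill-graph ks (refl ∷ M⊆f)

fill-⊇ : ∀ {f} ks {M p} → p ∈ M → p ∈ fill f ks M
fill-⊇     []       p∈M = p∈M
fill-⊇ {f} (k ∷ ks) p∈M = fill-⊇ {f} ks (there p∈M)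

fill-∈ : ∀ {f k} ks {M} → k ∈ ks → (k , f k) ∈ fill f ks M
fill-∈ {f} (k ∷ ks) (here refl) = fill-⊇ {f} ks (here refl)
fill-∈ {f} (_ ∷ ks) (there k∈)  = fill-∈ {f} ks k∈

ports : List Port
ports = port 0F false before ∷ port 0F false after ∷ port 1F false before ∷ port 1F false after
      ∷ port 0F true before  ∷ port 0F true after  ∷ port 1F true before  ∷ port 1F true after  ∷ []

ports-complete : ∀ k → k ∈ ports
ports-complete = toWitness {a? = allCorners? λ k → Any.any? (k ≟ᶜ_) ports} _

opaque
  unfolding spans?

  -- The combinatorial core: every pairing of the eight ports is evaluated for all four choices of
  -- present edges, and pairings that do not join neighbouring corners hold vacuously. Only here is
  -- `spans?` unfolded.
  parity-search : Search ports [] ParityIfNeighbouring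
  parity-search = toWitness {a? = search? ports [] parityIfNeighbouring?} _

tabulated-fill : ∀ f k l → Tabulated (fill f ports []) k l ⇔ Mate f k l
tabulated-fill f k l = mk⇔
  (Sum.map₂ (All.lookup (fill-graph {f} ports [])))
  (Sum.map₂ λ { refl → fill-∈ {f} ports (ports-complete k) })

-- Reducing a paired relation to a table on eight ports

module Embedded {A : Set} {R : Rel A 0ℓ} (R-eq : IsEquivalence R)
                (ι : Port → A) (ι-inj : ∀ {k l} → ι k ≡ ι l → k ≡ l)
                (pair : PairedOn (λ x → ∃[ k ] x ≡ ι k) R) where

  open IsEquivalence R-eq renaming (refl to reflᴿ; sym to symᴿ)

  partner : ∀ k → ∃[ l ] (l ≢ k × R (ι k) (ι l) × (∀ m → R (ι k) (ι m) → m ≡ k ⊎ m ≡ l))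
  partner k with pair (ι k) (k , refl)
  ... | _ , (l , refl) , l≢k , kl , uniq =
    l , l≢k ∘ cong ι , kl , λ m km → Sum.map ι-inj ι-inj (uniq (ι m) (m , refl) km)

  mate : Port → Port
  mate = proj₁ ∘ partner

  mate-involutive : ∀ k → mate (mate k) ≡ k
  mate-involutive k with partner k
  ... | l , l≢k , kl , _ with partner l
  ...   | m , _ , _ , uniq with uniq k (symᴿ kl)
  ...     | inj₁ k≡l = contradiction (sym k≡l) l≢k
  ...     | inj₂ k≡m = sym k≡m

  table : Table
  table = fill mate ports []

  tabulated⇔ : ∀ k l → Tabulated table k l ⇔ R (ι k) (ι l)
  tabulated⇔ k l = mk⇔ to (proj₂ (proj₂ (proj₂ (partner k))) l) ⇔-∘ tabulated-fill mate k l
    where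
    to : Mate mate k l → R (ι k) (ι l)
    to (inj₁ refl) = reflᴿ
    to (inj₂ refl) = proj₁ (proj₂ (proj₂ (partner k)))

  -- A class of `R` that avoids the ports violates this; in the outer part such a class is a closed
  -- curve.
  Covered : Set
  Covered = ∀ x → ∃[ k ] R x (ι k)

  -- Added arcs end at ports only, so a class without ports stays isolated; once every class has a
  -- port, all depends on whether the ports are linked.
  total⇔spans : ∀ L → Total (Linked R (map (both ι) L)) ⇔ (Covered × Spans table L)
  total⇔spans L = mk⇔
    (λ total → (λ x → meets L basePort (total x (ι basePort))) ,
               λ l → Equivalence.from (linked-map ι tabulated⇔ L basePort l) (total _ _))
    (λ (covered , spans) x y →
      let k , xk = covered x
          l , yl = covered y
          reach = λ l → Equivalence.to (linked-map ι tabulated⇔ L basePort l) (spans l)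
      in transᴸ (linked-base ιL xk)
           (transᴸ (symᴸ (reach k)) (transᴸ (reach l) (linked-base ιL (symᴿ yl)))))
    where
    ιL = map (both ι) L
    open IsEquivalence (linked-isEquivalence R-eq ιL) renaming (sym to symᴸ; trans to transᴸ)
    -- Dropping arcs one by one, `x` stays linked to the old port or to an end of the dropped arc,
    -- which is a port too.
    meets : ∀ L {x} k → Linked R (map (both ι) L) x (ι k) → ∃[ l ] R x (ι l)
    meets []            k r                     = k , r
    meets (_ ∷ L)       k (inj₁ r)              = meets L k r
    meets ((u , _) ∷ L) k (inj₂ (inj₁ (r , _))) = meets L u r
    meets ((_ , v) ∷ L) k (inj₂ (inj₂ (r , _))) = meets L v r

  parity : Neighbouring (λ k l → R (ι k) (ι l)) → Parity table
  parity = search-sound {C = ParityIfNeighbouring} (proj₁ ∘ proj₂ ∘ partner) mate-involutive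
             ports [] parity-search ∘ Sum.map (at λ ()) (at λ ())
    where
    at : ∀ {k l} → k ≢ l → R (ι k) (ι l) → (k , l) ∈ table
    at {k} {l} k≢l r with Equivalence.from (tabulated⇔ k l) r
    ... | inj₁ l≡k = contradiction (sym l≡k) k≢l
    ... | inj₂ kl∈ = kl∈

-- The two exchanged edges and the other ribbons

xor-true-≢ : ∀ x → x xor true ≢ x
xor-true-≢ false ()
xor-true-≢ true  ()

AgreeOff : Fin n → Fin n → Subset n → Subset n → Set
AgreeOff a b φ χ = ∀ e → e ≢ a → e ≢ b → lookup χ e ≡ lookup φ e

module TwoEdges {n : ℕ} (tw : Fin n → Bool) {a b : Fin n} (a≢b : a ≢ b) (i j : Bool) where

  -- The port ends `false` become the exchanged ends `(a , i)` and `(b , j)`. The names of the far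
  -- sides absorb the twists, so `portArcs` serves twisted and untwisted ribbons alike.
  embed : Port → Corner n
  embed ((0F , far) , s) = edgeCorner tw a i far s
  embed ((1F , far) , s) = edgeCorner tw b j far s

  embed-injective : ∀ {k l} → embed k ≡ embed l → k ≡ l
  embed-injective {(0F , k) , s} {(0F , l) , t} eq
    with refl , refl ← edgeCorner-injective tw a i {k} {s} {l} {t} eq = refl
  embed-injective {(1F , k) , s} {(1F , l) , t} eq
    with refl , refl ← edgeCorner-injective tw b j {k} {s} {l} {t} eq = refl
  embed-injective {(0F , _) , _} {(1F , _) , _} eq = contradiction (cong (proj₁ ∘ proj₁) eq) a≢b
  embed-injective {(1F , _) , _} {(0F , _) , _} eq = contradiction (sym (cong (proj₁ ∘ proj₁) eq)) a≢b

  swapCorner : Corner n → Corner n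
  swapCorner (h , s) = swap (a , i) (b , j) h , s

  swapCorner-involutive : ∀ c → swapCorner (swapCorner c) ≡ c
  swapCorner-involutive (h , s) = cong (_, s) (swap-involutive (a , i) (b , j) h)

  swapCorner-injective : ∀ {c d} → swapCorner c ≡ swapCorner d → c ≡ d
  swapCorner-injective eq =
    trans (sym (swapCorner-involutive _)) (trans (cong swapCorner eq) (swapCorner-involutive _))

  swapCorner-fixed : ∀ {e k s} → e ≢ a → e ≢ b → swapCorner ((e , k) , s) ≡ ((e , k) , s)
  swapCorner-fixed e≢a e≢b = cong (_, _) (swap-fixed _ _ (e≢a ∘ cong proj₁) (e≢b ∘ cong proj₁))

  -- Only the near ends move, and there `along` is the identity, so the twists of the two edges do
  -- not interfere.
  swapCorner-embed : ∀ k → swapCorner (embed k) ≡ embed (swapPort k)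
  swapCorner-embed ((0F , false) , s) rewrite Bool.xor-identityʳ i | Bool.xor-identityʳ j =
    cong (_, s) (swap-α (a , i) (b , j))
  swapCorner-embed ((1F , false) , s) rewrite Bool.xor-identityʳ i | Bool.xor-identityʳ j =
    cong (_, s) (swap-β (a , i) (b , j))
  swapCorner-embed ((0F , true) , s) =
    cong (_, _) (swap-fixed _ _ (xor-true-≢ i ∘ cong proj₂) (a≢b ∘ cong proj₁))
  swapCorner-embed ((1F , true) , s) =
    cong (_, _) (swap-fixed _ _ (a≢b ∘ sym ∘ cong proj₁) (xor-true-≢ j ∘ cong proj₂))

  edgeArcs : Subset n → List (Corner n × Corner n)
  edgeArcs φ = ribbon (lookup φ a) (edgeCorner tw a i) ++ ribbon (lookup φ b) (edgeCorner tw b j)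

  edgeArcs-embed : ∀ φ → edgeArcs φ ≡ map (both embed) (portArcs (lookup φ a) (lookup φ b))
  edgeArcs-embed φ with lookup φ a | lookup φ b
  ... | true  | true  = refl
  ... | true  | false = refl
  ... | false | true  = refl
  ... | false | false = refl

  swap-edgeArcs : ∀ φ → map (both swapCorner) (edgeArcs φ) ≡
                        map (both embed) (portArcs′ (lookup φ a) (lookup φ b))
  swap-edgeArcs φ = begin
    map (both swapCorner) (edgeArcs φ)          ≡⟨ cong (map (both swapCorner)) (edgeArcs-embed φ) ⟩
    map (both swapCorner) (map (both embed) L)  ≡⟨ map-∘ L ⟨
    map (both swapCorner ∘ both embed) L        ≡⟨ map-cong swap-both L ⟩
    map (both embed ∘ both swapPort) L          ≡⟨ map-∘ L ⟩
    map (both embed) (map (both swapPort) L)    ∎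
    where
    open ≡-Reasoning
    L = portArcs (lookup φ a) (lookup φ b)
    swap-both : ∀ p → both swapCorner (both embed p) ≡ both embed (both swapPort p)
    swap-both (k , l) = cong₂ _,_ (swapCorner-embed k) (swapCorner-embed l)

  others : List (Fin n)
  others = filter (λ e → ¬? (e Fin.≟ a) ×-dec ¬? (e Fin.≟ b)) (allFin n)

  others-unique : Unique others
  others-unique = filter⁺ _ (allFin⁺ n)

  ∈-others : ∀ {e} → e ≢ a → e ≢ b → e ∈ others
  ∈-others e≢a e≢b = ∈-filter⁺ _ (∈-allFin _) (e≢a , e≢b)

  others-≢ : All (λ e → e ≢ a × e ≢ b) others
  others-≢ = All.tabulate λ e∈ → proj₂ (∈-filter⁻ _ {xs = allFin n} e∈)

  ribbons-swap : ∀ φ {es} → All (λ e → e ≢ a × e ≢ b) es →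
                 map (both swapCorner) (ribbons tw φ es) ≡ ribbons tw φ es
  ribbons-swap φ [] = refl
  ribbons-swap φ {e ∷ _} ((e≢a , e≢b) ∷ es≢) with lookup φ e
  ... | true  = cong₂ _∷_ (cong₂ _,_ fixed fixed) (cong₂ _∷_ (cong₂ _,_ fixed fixed) (ribbons-swap φ es≢))
    where
    fixed : ∀ {k s} → swapCorner ((e , k) , s) ≡ ((e , k) , s)
    fixed = swapCorner-fixed e≢a e≢b
  ... | false = cong₂ _∷_ (cong₂ _,_ fixed fixed) (cong₂ _∷_ (cong₂ _,_ fixed fixed) (ribbons-swap φ es≢))
    where
    fixed : ∀ {k s} → swapCorner ((e , k) , s) ≡ ((e , k) , s)
    fixed = swapCorner-fixed e≢a e≢b

  ribbons-cong : ∀ {φ χ es} → All (λ e → lookup χ e ≡ lookup φ e) es → ribbons tw χ es ≡ ribbons tw φ es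
  ribbons-cong []       = refl
  ribbons-cong {φ} {χ} (p ∷ ps) = cong₂ _++_ (cong (λ x → ribbon x _) p) (ribbons-cong {φ} {χ} ps)

-- The boundary cut open along the two edges

module OuterPart (Γ : RibbonGraph n) {a b : Fin n} (a≢b : a ≢ b) (i j : Bool) where
  open RibbonGraph Γ
  open TwoEdges twisted a≢b i j

  Outer : Subset n → Rel (Corner n) 0ℓ
  Outer φ = Linked (Mate (gapMate Γ)) (ribbons twisted φ others)

  outer-isEquivalence : ∀ φ → IsEquivalence (Outer φ)
  outer-isEquivalence φ = linked-isEquivalence (gaps-isEquivalence Γ) (ribbons twisted φ others)

  -- `others` omits `a` and `b`, so sets that differ only there, such as `ψ` and `delete ψ`, have
  -- the same outer part and can be tested on one table.
  outer-cong : ∀ {φ χ} → AgreeOff a b φ χ → Outer χ ≡ Outer φ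
  outer-cong {φ} {χ} agree =
    cong (Linked _) (ribbons-cong {φ} {χ} (All.map (λ (≢a , ≢b) → agree _ ≢a ≢b) others-≢))

  outer-pairedOn : ∀ φ → PairedOn (λ c → ∃[ k ] c ≡ embed k) (Outer φ)
  outer-pairedOn φ = pairedOn-resp (to , from)
    (ribbons-pairedOn (gaps-isEquivalence Γ) (gaps-pairedOn Γ) twisted φ others-unique)
    where
    to : ∀ {c : Corner n} → proj₁ (proj₁ c) ∉ others → ∃[ k ] c ≡ embed k
    to {(e , k) , s} e∉ with e Fin.≟ a | e Fin.≟ b
    ... | yes refl | _        = let k′ , s′ , eq = edgeCorner-surjective twisted a i k s in port 0F k′ s′ , eq
    ... | no _     | yes refl = let k′ , s′ , eq = edgeCorner-surjective twisted b j k s in port 1F k′ s′ , eq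
    ... | no e≢a   | no e≢b   = contradiction (∈-others e≢a e≢b) e∉
    from : ∀ {c : Corner n} → ∃[ k ] c ≡ embed k → proj₁ (proj₁ c) ∉ others
    from (((0F , _) , _) , refl) e∈ = proj₁ (All.lookup others-≢ e∈) refl
    from (((1F , _) , _) , refl) e∈ = proj₂ (All.lookup others-≢ e∈) refl

  feasible⇔total : ∀ φ → deltaMatroid Γ φ ⇔ Total (Linked (Outer φ) (edgeArcs φ))
  feasible⇔total φ = connected⇔total Γ (a , i) S-eq (linked-least J-eq outer⇒joined edgeArcs-joined) arc
    where
    S = Linked (Outer φ) (edgeArcs φ)
    J-eq = joined-isEquivalence Γ φ
    S-eq = linked-isEquivalence (outer-isEquivalence φ) (edgeArcs φ)
    outer⇒joined : Outer φ ⇒ Joined Γ φ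
    outer⇒joined = linked-least J-eq (mate⇒joined Γ φ)
      (All.concat⁺ (All.map⁺ (All.universal (λ e → ribbon⊆joined Γ φ e false) others)))
    edgeArcs-joined : All (uncurry (Joined Γ φ)) (edgeArcs φ)
    edgeArcs-joined = All.++⁺ (ribbon⊆joined Γ φ a i) (ribbon⊆joined Γ φ b j)
    -- The ribbons of `a` and `b` are listed from their exchanged ends, all others from the end
    -- `false`; `k` records which.
    ribbon⊆ : ∀ e → ∃[ k ] All (uncurry S) (ribbon (lookup φ e) (edgeCorner twisted e k))
    ribbon⊆ e with e Fin.≟ a | e Fin.≟ b
    ... | yes refl | _        = i , All.++⁻ˡ _ (linked-arcs (outer-isEquivalence φ) (edgeArcs φ))
    ... | no _     | yes refl =
      j , All.++⁻ʳ (ribbon (lookup φ a) _) (linked-arcs (outer-isEquivalence φ) (edgeArcs φ))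
    ... | no e≢a   | no e≢b   = false , All.map (linked-base (edgeArcs φ))
      (All.lookup (All.map⁻ (All.concat⁻ (linked-arcs (gaps-isEquivalence Γ) (ribbons twisted φ others))))
        (∈-others e≢a e≢b))
    arc : ∀ {p q} → Arc Γ φ p q → S (cornerOf Γ (a , i) p) (cornerOf Γ (a , i) q)
    arc (gap h)      = linked-base (edgeArcs φ) (linked-base (ribbons twisted φ others) (inj₂ refl))
    arc (cap k e∉φ)  = let k′ , ss = ribbon⊆ _ in cap∈ribbon Γ φ k′ S-eq ss e∉φ k
    arc (edge s e∈φ) = let k′ , ss = ribbon⊆ _ in edge∈ribbon Γ φ k′ S-eq ss e∈φ s

-- Comparing the graphs before and after the exchange

module Exchanged (Γ : RibbonGraph n) {a b : Fin n} (a≢b : a ≢ b) (i j : Bool)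
                 (nb : Neighbours Γ (a , i) (b , j)) where
  open RibbonGraph Γ
  open TwoEdges twisted a≢b i j
  open OuterPart Γ a≢b i j

  Γ′ : RibbonGraph n
  Γ′ = exchange Γ (a , i) (b , j) nb

  -- The new rotation is the old one conjugated by the transposition, so renaming corners by it
  -- carries the gaps of `Γ′` to those of `Γ`.
  gapMate-exchange : ∀ c → gapMate Γ (swapCorner c) ≡ swapCorner (gapMate Γ′ c)
  gapMate-exchange (h , after)  = cong (_, before) (sym (swap-involutive (a , i) (b , j) _))
  gapMate-exchange (h , before) = cong (_, after) (sym (swap-involutive (a , i) (b , j) _))

  mate-exchange : ∀ x y → Mate (gapMate Γ′) x y ⇔ Mate (gapMate Γ) (swapCorner x) (swapCorner y)
  mate-exchange x y = mk⇔
    (λ { (inj₁ refl) → inj₁ refl ; (inj₂ refl) → inj₂ (sym (gapMate-exchange x)) })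
    (Sum.map swapCorner-injective (λ eq → swapCorner-injective (trans eq (gapMate-exchange x))))

  -- Renaming by `swapCorner` turns the outer part of `Γ′` into that of `Γ`: gaps correspond by
  -- `mate-exchange`, and the corners of the other ribbons are fixed. Only the arcs of `a` and `b`
  -- change.
  feasible′⇔total : ∀ φ → deltaMatroid Γ′ φ ⇔ Total (Linked (Outer φ) (map (both swapCorner) (edgeArcs φ)))
  feasible′⇔total φ =
    total-cong swapCorner swapCorner swapCorner-involutive (linked-map swapCorner outer⇔ (edgeArcs φ))
    ⇔-∘ OuterPart.feasible⇔total Γ′ a≢b i j φ
    where
    Outer′ : Rel (Corner n) 0ℓ
    Outer′ = OuterPart.Outer Γ′ a≢b i j φ
    outer⇔ : ∀ x y → Outer′ x y ⇔ Outer φ (swapCorner x) (swapCorner y)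
    outer⇔ x y = subst (λ L → Outer′ x y ⇔ Linked (Mate (gapMate Γ)) L (swapCorner x) (swapCorner y))
      (ribbons-swap φ others-≢)
      (linked-map swapCorner mate-exchange (ribbons twisted φ others) x y)

  outer-neighbouring : ∀ φ → Neighbouring (λ k l → Outer φ (embed k) (embed l))
  outer-neighbouring φ rewrite Bool.xor-identityʳ i | Bool.xor-identityʳ j = Sum.map step step nb
    where
    step : ∀ {h k} → next h ≡ k → Outer φ (h , after) (k , before)
    step refl = linked-base (ribbons twisted φ others) (inj₂ refl)

  -- The interface between topology and set systems: the condition on closed curves is common to
  -- both graphs and to all `χ` agreeing with `φ` off `a` and `b`, so only the Boolean functions `F`
  -- and `F′` remain to be compared.
  record Feasibility (φ : Subset n) : Set₁ where
    field
      NoClosedCurve : Set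
      F F′          : Bool → Bool → Bool
      parity        : ∀ x y → F′ x y ≡ F x y xor (x ∧ y ∧ F false false)
      feasible⇔     : ∀ χ → AgreeOff a b φ χ →
                      deltaMatroid Γ χ ⇔ (NoClosedCurve × F (lookup χ a) (lookup χ b) ≡ true)
      feasible′⇔    : ∀ χ → AgreeOff a b φ χ →
                      deltaMatroid Γ′ χ ⇔ (NoClosedCurve × F′ (lookup χ a) (lookup χ b) ≡ true)

  feasibility : ∀ φ → Feasibility φ
  feasibility φ = record
    { NoClosedCurve = E.Covered
    ; F             = λ x y → does (spans? E.table (portArcs x y))
    ; F′            = λ x y → does (spans? E.table (portArcs′ x y))
    ; parity        = E.parity (outer-neighbouring φ)
    ; feasible⇔     = λ χ agree → does⇔ (portArcs (lookup χ a) (lookup χ b))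
        ⇔-∘ subst₂ (λ R L → deltaMatroid Γ χ ⇔ Total (Linked R L))
              (outer-cong {φ} {χ} agree) (edgeArcs-embed χ) (feasible⇔total χ)
    ; feasible′⇔    = λ χ agree → does⇔ (portArcs′ (lookup χ a) (lookup χ b))
        ⇔-∘ subst₂ (λ R L → deltaMatroid Γ′ χ ⇔ Total (Linked R L))
              (outer-cong {φ} {χ} agree) (swap-edgeArcs χ) (feasible′⇔total χ)
    }
    where
    module E = Embedded (outer-isEquivalence φ) embed embed-injective (outer-pairedOn φ)
    true⇒ : ∀ {P : Set} (P? : Dec P) → does P? ≡ true → P
    true⇒ (yes p) _ = p
    does⇔ : ∀ L → Total (Linked (Outer φ) (map (both embed) L)) ⇔
                  (E.Covered × does (spans? E.table L) ≡ true)
    does⇔ L = mk⇔ (Product.map₂ (dec-true (spans? _ L))) (Product.map₂ (true⇒ (spans? _ L)))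
              ⇔-∘ E.total⇔spans L

-- Set systems

lookup-injective : ∀ {p q : Subset n} → (∀ e → lookup p e ≡ lookup q e) → p ≡ q
lookup-injective p≗q = Pointwise-≡⇒≡ (ext p≗q)

lookup-∪ : ∀ (p q : Subset n) e → lookup (p Subset.∪ q) e ≡ lookup p e ∨ lookup q e
lookup-∪ p q e = lookup-zipWith _∨_ e p q

lookup-△ : ∀ (p q : Subset n) e → lookup (p △ q) e ≡ lookup p e xor lookup q e
lookup-△ (true  ∷ p) (true  ∷ q) 0F      = refl
lookup-△ (true  ∷ p) (false ∷ q) 0F      = refl
lookup-△ (false ∷ p) (true  ∷ q) 0F      = refl
lookup-△ (false ∷ p) (false ∷ q) 0F      = refl
lookup-△ (_     ∷ p) (_     ∷ q) (suc e) = lookup-△ p q e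

∉⇒lookup : ∀ {p : Subset n} {e} → e Subset.∉ p → lookup p e ≡ false
∉⇒lookup {p = p} {e} e∉p = Bool.¬-not (e∉p ∘ lookup⇒[]= e p)

lookup⇒∉ : ∀ {p : Subset n} {e} → lookup p e ≡ false → e Subset.∉ p
lookup⇒∉ p[e] e∈p = contradiction (trans (sym p[e]) ([]=⇒lookup e∈p)) λ ()

lookup-⁅⁆ : ∀ (e : Fin n) → lookup ⁅ e ⁆ e ≡ true
lookup-⁅⁆ e = []=⇒lookup (x∈⁅x⁆ e)

lookup-⁅⁆-≢ : ∀ {d e : Fin n} → d ≢ e → lookup ⁅ e ⁆ d ≡ false
lookup-⁅⁆-≢ d≢e = ∉⇒lookup (x≢y⇒x∉⁅y⁆ d≢e)

△-cancel : ∀ (p q : Subset n) → p △ q △ q ≡ p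
△-cancel p q = lookup-injective λ e →
  trans (lookup-△ (p △ q) q e) (trans (cong (_xor _) (lookup-△ p q e)) (xor-cancel (lookup p e) (lookup q e)))
  where
  xor-cancel : ∀ x y → (x xor y) xor y ≡ x
  xor-cancel x y =
    trans (Bool.xor-assoc x y y) (trans (cong (x xor_) (Bool.xor-same y)) (Bool.xor-identityʳ x))

twist⇔ : ∀ (D : SetSystem n) p q → (D * q) p ⇔ D (p △ q)
twist⇔ D p q = mk⇔
  (λ { (φ , Dφ , refl) → subst D (sym (△-cancel φ q)) Dφ })
  (λ Dpq → p △ q , Dpq , sym (△-cancel p q))

twist-△⇔ : ∀ (D : SetSystem n) p q → (D * q) (p △ q) ⇔ D p
twist-△⇔ D p q = subst (λ r → (D * q) (p △ q) ⇔ D r) (△-cancel p q) (twist⇔ D (p △ q) q)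

∪-⁅⁆-△ : ∀ {φ : Subset n} {b} → b Subset.∉ φ → φ Subset.∪ ⁅ b ⁆ ≡ φ △ ⁅ b ⁆
∪-⁅⁆-△ {φ = φ} {b} b∉φ = lookup-injective λ e →
  trans (lookup-∪ φ ⁅ b ⁆ e) (trans (disjoint e) (sym (lookup-△ φ ⁅ b ⁆ e)))
  where
  disjoint : ∀ e → lookup φ e ∨ lookup ⁅ b ⁆ e ≡ lookup φ e xor lookup ⁅ b ⁆ e
  disjoint e with e Fin.≟ b
  ... | yes refl rewrite ∉⇒lookup b∉φ = refl
  ... | no e≢b rewrite lookup-⁅⁆-≢ e≢b with lookup φ e
  ...   | true  = refl
  ...   | false = refl

module _ {a b : Fin n} (a≢b : a ≢ b) where

  delete : Subset n → Subset n
  delete ψ = ψ [ a ]≔ false [ b ]≔ false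

  lookup-delete-a : ∀ ψ → lookup (delete ψ) a ≡ false
  lookup-delete-a ψ = trans (lookup∘update′ a≢b (ψ [ a ]≔ false) false) (lookup∘update a ψ false)

  lookup-delete-b : ∀ ψ → lookup (delete ψ) b ≡ false
  lookup-delete-b ψ = lookup∘update b (ψ [ a ]≔ false) false

  delete-agree : ∀ ψ → AgreeOff a b ψ (delete ψ)
  delete-agree ψ e e≢a e≢b = trans (lookup∘update′ e≢b (ψ [ a ]≔ false) false) (lookup∘update′ e≢a ψ false)

  -- Compared coordinatewise: the right side omits `b`, which forces `b` into `ψ`; it contains `a`,
  -- which forces `a` into `ψ`; elsewhere `ψ` and `φ` agree.
  △≡∪⇔ : ∀ {ψ φ} → a Subset.∉ φ → b Subset.∉ φ →
         ψ △ ⁅ b ⁆ ≡ φ Subset.∪ ⁅ a ⁆ ⇔ (lookup ψ a ≡ true × lookup ψ b ≡ true × delete ψ ≡ φ)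
  △≡∪⇔ {ψ} {φ} a∉φ b∉φ = mk⇔
    (λ eq → to a∈ eq , to b∈ eq , lookup-injective (λ e → to (same e) eq))
    (λ (ψa , ψb , ψ≡φ) → lookup-injective λ e →
      trans (lookup-△ ψ ⁅ b ⁆ e) (trans (from ψa ψb ψ≡φ e) (sym (lookup-∪ φ ⁅ a ⁆ e))))
    where
    At : Fin n → Set
    At e = lookup ψ e xor lookup ⁅ b ⁆ e ≡ lookup φ e ∨ lookup ⁅ a ⁆ e
    to : ∀ {e} {P : Set} → (At e → P) → ψ △ ⁅ b ⁆ ≡ φ Subset.∪ ⁅ a ⁆ → P
    to {e} f eq = f (trans (sym (lookup-△ ψ ⁅ b ⁆ e)) (trans (cong (λ p → lookup p e) eq) (lookup-∪ φ ⁅ a ⁆ e)))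
    a∈ : At a → lookup ψ a ≡ true
    a∈ rewrite lookup-⁅⁆-≢ a≢b | lookup-⁅⁆ a | ∉⇒lookup a∉φ = trans (sym (Bool.xor-identityʳ _))
    b∈ : At b → lookup ψ b ≡ true
    b∈ rewrite lookup-⁅⁆-≢ (a≢b ∘ sym) | lookup-⁅⁆ b | ∉⇒lookup b∉φ with lookup ψ b
    ... | true  = λ _ → refl
    ... | false = sym
    same : ∀ e → At e → lookup (delete ψ) e ≡ lookup φ e
    same e with e Fin.≟ a | e Fin.≟ b
    ... | yes refl | _        = λ _ → trans (lookup-delete-a ψ) (sym (∉⇒lookup a∉φ))
    ... | no _     | yes refl = λ _ → trans (lookup-delete-b ψ) (sym (∉⇒lookup b∉φ))
    ... | no e≢a   | no e≢b rewrite delete-agree ψ e e≢a e≢b | lookup-⁅⁆-≢ e≢a | lookup-⁅⁆-≢ e≢b =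
      λ eq → trans (sym (Bool.xor-identityʳ _)) (trans eq (Bool.∨-identityʳ _))
    from : lookup ψ a ≡ true → lookup ψ b ≡ true → delete ψ ≡ φ → ∀ e → At e
    from ψa ψb refl e with e Fin.≟ a | e Fin.≟ b
    ... | yes refl | _ rewrite ψa | lookup-⁅⁆-≢ a≢b | lookup-⁅⁆ a = sym (Bool.∨-zeroʳ _)
    ... | no _ | yes refl rewrite ψb | lookup-⁅⁆-≢ (a≢b ∘ sym) | lookup-⁅⁆ b | lookup-delete-b ψ = refl
    ... | no e≢a | no e≢b rewrite delete-agree ψ e e≢a e≢b | lookup-⁅⁆-≢ e≢a | lookup-⁅⁆-≢ e≢b =
      trans (Bool.xor-identityʳ _) (sym (Bool.∨-identityʳ _))

  module _ (D : SetSystem n) (ψ : Subset n) where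

    ContainsBoth : Set
    ContainsBoth = lookup ψ a ≡ true × lookup ψ b ≡ true × D (delete ψ)

    -- For `b` outside `φ`, adding `b` is twisting by `b`, so the two twists cancel and the
    -- condition on `φ` becomes membership in `D` itself.
    slid⇔ : slid (D * ⁅ b ⁆) a b (ψ △ ⁅ b ⁆) ⇔ ContainsBoth
    slid⇔ = mk⇔ to from
      where
      shift : ∀ {φ} → b Subset.∉ φ → (D * ⁅ b ⁆) (φ Subset.∪ ⁅ b ⁆) ⇔ D φ
      shift {φ} b∉φ = subst (λ p → (D * ⁅ b ⁆) p ⇔ D φ) (sym (∪-⁅⁆-△ b∉φ)) (twist-△⇔ D φ ⁅ b ⁆)
      to : slid (D * ⁅ b ⁆) a b (ψ △ ⁅ b ⁆) → ContainsBoth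
      to (φ , a∉φ , b∉φ , Dφb , eq) with Equivalence.to (△≡∪⇔ a∉φ b∉φ) eq
      ... | ψa , ψb , refl = ψa , ψb , Equivalence.to (shift b∉φ) Dφb
      from : ContainsBoth → slid (D * ⁅ b ⁆) a b (ψ △ ⁅ b ⁆)
      from (ψa , ψb , Dψ⁻) =
        delete ψ , a∉ , b∉ , Equivalence.from (shift b∉) Dψ⁻ , Equivalence.from (△≡∪⇔ a∉ b∉) (ψa , ψb , refl)
        where
        a∉ = lookup⇒∉ (lookup-delete-a ψ)
        b∉ = lookup⇒∉ (lookup-delete-b ψ)

    -- The outer twist moves the test to `ψ △ ⁅ b ⁆` and the inner one undoes this. What remains is
    -- the symmetric difference of `D` with the family `ContainsBoth`.
    exchangeEnds⇔ : exchangeEnds D a b ψ ⇔ (D ψ × ¬ ContainsBoth ⊎ ContainsBoth × ¬ D ψ)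
    exchangeEnds⇔ = mk⇔
      (Sum.map (Product.map (to D⇔) (_∘ from slid⇔)) (Product.map (to slid⇔) (_∘ from D⇔)))
      (Sum.map (Product.map (from D⇔) (_∘ to slid⇔)) (Product.map (from slid⇔) (_∘ to D⇔)))
      ⇔-∘ twist⇔ (slide (D * ⁅ b ⁆) a b) ψ ⁅ b ⁆
      where
      open Equivalence using (to; from)
      D⇔ = twist-△⇔ D ψ ⁅ b ⁆

-- Whichever of `Q` and `S` holds supplies the common condition `C`; the negation of the other then
-- says just that its Boolean is false.
xor⇔ : ∀ {C P Q S : Set} {p q s} → P ⇔ (C × p ≡ true) → Q ⇔ (C × q ≡ true) → S ⇔ (C × s ≡ true) →
       p ≡ q xor s → P ⇔ (Q × ¬ S ⊎ S × ¬ Q)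
xor⇔ {C} {P} {Q} {S} {p} {q} {s} P⇔ Q⇔ S⇔ p≡ = mk⇔ (λ P → split q s p≡ Q⇔ S⇔ (to P⇔ P)) merge
  where
  open Equivalence
  split : ∀ q s → p ≡ q xor s → Q ⇔ (C × q ≡ true) → S ⇔ (C × s ≡ true) →
          C × p ≡ true → Q × ¬ S ⊎ S × ¬ Q
  split true  false _  Q⇔ S⇔ (c , _) = inj₁ (from Q⇔ (c , refl) , λ S → contradiction (proj₂ (to S⇔ S)) λ ())
  split false true  _  Q⇔ S⇔ (c , _) = inj₂ (from S⇔ (c , refl) , λ Q → contradiction (proj₂ (to Q⇔ Q)) λ ())
  split true  true  p≡ _  _  (_ , p) = contradiction (trans (sym p≡) p) λ ()
  split false false p≡ _  _  (_ , p) = contradiction (trans (sym p≡) p) λ ()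
  merge : Q × ¬ S ⊎ S × ¬ Q → P
  merge (inj₁ (Q , ¬S)) with c , refl ← to Q⇔ Q =
    from P⇔ (c , trans p≡ (cong not (Bool.¬-not λ s → ¬S (from S⇔ (c , s)))))
  merge (inj₂ (S , ¬Q)) with c , refl ← to S⇔ S =
    from P⇔ (c , trans p≡ (cong (_xor true) (Bool.¬-not λ q → ¬Q (from Q⇔ (c , q)))))

∧-true⇔ : ∀ {C : Set} {x y z} → (x ≡ true × y ≡ true × C × z ≡ true) ⇔ (C × x ∧ y ∧ z ≡ true)
∧-true⇔ {C} {x} {y} {z} = mk⇔ (λ { (refl , refl , c) → c }) (from x y)
  where
  from : ∀ x y → C × x ∧ y ∧ z ≡ true → x ≡ true × y ≡ true × C × z ≡ true
  from true true c = refl , refl , c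

theorem4p3 : ∀ {n : ℕ} (Γ : RibbonGraph n) (a b : Fin n) → a ≢ b →
    ∀ (i j : Bool) (nb : Neighbours Γ (a , i) (b , j)) →
    deltaMatroid (exchange Γ (a , i) (b , j) nb) ≐ exchangeEnds (deltaMatroid Γ) a b
theorem4p3 Γ a b a≢b i j nb = Equivalence.to (main _) , Equivalence.from (main _)
  where
  open Exchanged Γ a≢b i j nb
  main : ∀ ψ → deltaMatroid Γ′ ψ ⇔ exchangeEnds (deltaMatroid Γ) a b ψ
  main ψ = ⇔-sym (exchangeEnds⇔ a≢b (deltaMatroid Γ) ψ)
    ⇔-∘ xor⇔ (feasible′⇔ ψ agree) (feasible⇔ ψ agree) both⇔ (parity (lookup ψ a) (lookup ψ b))
    where
    open Feasibility (feasibility ψ)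
    agree : AgreeOff a b ψ ψ
    agree _ _ _ = refl
    -- `delete ψ` agrees with `ψ` off `a` and `b`, so the same `F` tests it, at `false` and `false`:
    -- the correction term of `parity`.
    delete⇔ : deltaMatroid Γ (delete a≢b ψ) ⇔ (NoClosedCurve × F false false ≡ true)
    delete⇔ = subst₂ (λ x y → deltaMatroid Γ (delete a≢b ψ) ⇔ (NoClosedCurve × F x y ≡ true))
      (lookup-delete-a a≢b ψ) (lookup-delete-b a≢b ψ) (feasible⇔ (delete a≢b ψ) (delete-agree a≢b ψ))
    both⇔ : ContainsBoth a≢b (deltaMatroid Γ) ψ ⇔
            (NoClosedCurve × lookup ψ a ∧ lookup ψ b ∧ F false false ≡ true)
    both⇔ = ∧-true⇔ ⇔-∘ mk⇔ (Product.map₂ (Product.map₂ (Equivalence.to delete⇔)))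
                            (Product.map₂ (Product.map₂ (Equivalence.from delete⇔)))
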